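{- Let $(T,\tilde T)$ be a fibred monad over a fibration $p:\mathcal E\to\mathcal B$. Let $J:\mathcal B\to\mathcal B_T$ and $\tilde J:\mathcal E\to\mathcal E_{\tilde T}$ be the Kleisli left adjoints, and let $p_T:\mathcal E_{\tilde T}\to\mathcal B_T$ be the induced functor $p_T(X)=pX$, $p_T(f:X\to\tilde TY)=(pf:pX\to TpY)$. Then $p_T$ is a fibration and the square $p_T\circ\tilde J=J\circ p$ is a pullback in $\mathbf{Cat}$. Moreover, if $\mathcal E$ and $\mathcal B$ are monoidal and $p$ is strict monoidal, and if $T$ and $\tilde T$ are both strong monads such that the strength $\tilde t$ of $\tilde T$ is above the strength $t$ of $T$ (i.e. $p\tilde t=t_{p,p}$), then both $\mathcal B_T$ and $\mathcal E_{\tilde T}$ have an $\mathcal E$-action (namely the ones described in the context) and $p_T$ strictly preserves it.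
   Context: A fibred monad over a fibration $p:\mathcal E\to\mathcal B$ is a pair of monads $(T,\eta,\mu)$ on $\mathcal B$ and $(\tilde T,\tilde\eta,\tilde\mu)$ on $\mathcal E$ with $p\tilde T=Tp$, $p\tilde\eta=\eta_p$, $p\tilde\mu=\mu_p$, such that $\tilde T$ preserves $p$-cartesian morphisms and all components of $\tilde\eta$ and $\tilde\mu$ are $p$-cartesian. $\mathcal B_T$ and $\mathcal E_{\tilde T}$ are the Kleisli categories: same objects as $\mathcal B$, $\mathcal E$; morphisms $K\to L$ in $\mathcal B_T$ are morphisms $K\to TL$ in $\mathcal B$, and similarly for $\mathcal E_{\tilde T}$. $J$ and $\tilde J$ are identity on objects and send $f$ to $\eta\circ f$, resp. $\tilde\eta\circ f$. A strong monad on a monoidal category is a monad $T$ with a natural transformation (strength) $t_{A,B}:A\otimes TB\to T(A\otimes B)$ compatible with the left unitor, the associator, and the unit and multiplication of $T$. For a monoidal category $(\mathcal M,\otimes,I)$, an $\mathcal M$-action on a category $\mathcal C$ is a bifunctor $(-)\cdot(-):\mathcal M\times\mathcal C\to\mathcal C$ with natural isomorphisms $\eta_c:I\cdot c\to c$ and $\mu_{m_1,m_2,c}:(m_1\otimes m_2)\cdot c\to m_1\cdot(m_2\cdot c)$ such that (suppressing associators) $\mu_{m_1,m_2,m_3\cdot c}\circ\mu_{m_1\otimes m_2,m_3,c}=(\mathrm{id}\cdot\mu_{m_2,m_3,c})\circ\mu_{m_1,m_2\otimes m_3,c}$ and $(\mathrm{id}_m\cdot\eta_c)\circ\mu_{m,I,c}=r_m\cdot\mathrm{id}_c$,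 with $r_m$ the right unitor. A functor between $\mathcal M$-actegories strictly preserves the action if it commutes with the actions and their structure isomorphisms on the nose. The $\mathcal E$-action on $\mathcal E_{\tilde T}$ extends the tensor of $\mathcal E$ by the strength: $X\cdot Y=X\otimes Y$ and $(f:X\to X')\cdot(g:Y\to\tilde TY')=\tilde t\circ(f\otimes g)$. The $\mathcal E$-action on $\mathcal B_T$ is the change of base along $p$ of the analogous $\mathcal B$-action: $X\cdot K=pX\otimes K$ and $(f:X\to X')\cdot(g:K\to TL)=t\circ(pf\otimes g)$. The structure isomorphisms are those induced from the monoidal structures via $\tilde J$ and $J$. -}

module Defs where

open import Data.Product using (_×_; _,_; proj₁; proj₂)
open import Level using (Level; _⊔_; suc)
open import Relation.Binary.Bundles using (Setoid)
open import Relation.Binary.PropositionalEquality using (_≡_; refl; sym; subst)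
open import Relation.Binary.Structures using (IsEquivalence)
import Relation.Binary.Reasoning.Setoid as SetoidReasoning

private
  variable
    o ℓ e o′ ℓ′ e′ o″ ℓ″ e″ o‴ ℓ‴ e‴ : Level

-- Hom-sets are setoids, objects are compared with _≡_.
record Category (o ℓ e : Level) : Set (suc (o ⊔ ℓ ⊔ e)) where
  infix  4 _⇒_ _≈_ _≈ʰ_
  infixr 9 _∘_
  field
    Obj : Set o
    _⇒_ : Obj → Obj → Set ℓ
    _≈_ : ∀ {A B} → A ⇒ B → A ⇒ B → Set e
    id  : ∀ {A} → A ⇒ A
    _∘_ : ∀ {A B C} → B ⇒ C → A ⇒ B → A ⇒ C

    equiv     : ∀ {A B} → IsEquivalence (_≈_ {A} {B})
    ∘-resp-≈  : ∀ {A B C} {g g′ : B ⇒ C} {f f′ : A ⇒ B} →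
                g ≈ g′ → f ≈ f′ → g ∘ f ≈ g′ ∘ f′
    assoc     : ∀ {A B C D} {f : A ⇒ B} {g : B ⇒ C} {h : C ⇒ D} →
                (h ∘ g) ∘ f ≈ h ∘ (g ∘ f)
    identityˡ : ∀ {A B} {f : A ⇒ B} → id ∘ f ≈ f
    identityʳ : ∀ {A B} {f : A ⇒ B} → f ∘ id ≈ f

  homSetoid : Obj → Obj → Setoid ℓ e
  homSetoid A B = record { Carrier = A ⇒ B ; _≈_ = _≈_ ; isEquivalence = equiv }

  module Equiv {A B} = IsEquivalence (equiv {A} {B})

  -- Equality of morphisms whose domains and codomains are equal objects,
  -- though not necessarily by definition.
  data _≈ʰ_ {A B : Obj} (f : A ⇒ B) : ∀ {C D} → C ⇒ D → Set (ℓ ⊔ e) where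
    ≈⇒≈ʰ : ∀ {g : A ⇒ B} → f ≈ g → f ≈ʰ g

  ≈ʰ⇒≈ : ∀ {A B} {f g : A ⇒ B} → f ≈ʰ g → f ≈ g
  ≈ʰ⇒≈ (≈⇒≈ʰ q) = q

  ≈ʰ-refl : ∀ {A B} {f : A ⇒ B} → f ≈ʰ f
  ≈ʰ-refl = ≈⇒≈ʰ Equiv.refl

  ≈ʰ-sym : ∀ {A B C D} {f : A ⇒ B} {g : C ⇒ D} → f ≈ʰ g → g ≈ʰ f
  ≈ʰ-sym (≈⇒≈ʰ q) = ≈⇒≈ʰ (Equiv.sym q)

  ≈ʰ-trans : ∀ {A B C D A′ B′} {f : A ⇒ B} {g : C ⇒ D} {h : A′ ⇒ B′} →
             f ≈ʰ g → g ≈ʰ h → f ≈ʰ h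
  ≈ʰ-trans (≈⇒≈ʰ q) (≈⇒≈ʰ r) = ≈⇒≈ʰ (Equiv.trans q r)

  ∘-resp-≈ʰ : ∀ {A B C A′ B′ C′} {g : B ⇒ C} {g′ : B′ ⇒ C′} {f : A ⇒ B} {f′ : A′ ⇒ B′} →
              g ≈ʰ g′ → f ≈ʰ f′ → g ∘ f ≈ʰ g′ ∘ f′
  ∘-resp-≈ʰ (≈⇒≈ʰ q) (≈⇒≈ʰ r) = ≈⇒≈ʰ (∘-resp-≈ q r)

  subst-cod-≈ʰ : ∀ {A B C} (q : B ≡ C) (f : A ⇒ B) → subst (A ⇒_) q f ≈ʰ f
  subst-cod-≈ʰ refl f = ≈ʰ-refl

  record IsIso {A B} (f : A ⇒ B) : Set (ℓ ⊔ e) where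
    field
      inv  : B ⇒ A
      isoˡ : inv ∘ f ≈ id
      isoʳ : f ∘ inv ≈ id

Product : Category o ℓ e → Category o′ ℓ′ e′ → Category (o ⊔ o′) (ℓ ⊔ ℓ′) (e ⊔ e′)
Product C D = record
  { Obj       = C.Obj × D.Obj
  ; _⇒_       = λ (A , A′) (B , B′) → (A C.⇒ B) × (A′ D.⇒ B′)
  ; _≈_       = λ (f , f′) (g , g′) → (f C.≈ g) × (f′ D.≈ g′)
  ; id        = C.id , D.id
  ; _∘_       = λ (g , g′) (f , f′) → (g C.∘ f) , (g′ D.∘ f′)
  ; equiv     = record
    { refl  = C.Equiv.refl , D.Equiv.refl
    ; sym   = λ (q , q′) → C.Equiv.sym q , D.Equiv.sym q′
    ; trans = λ (q , q′) (r , r′) → C.Equiv.trans q r , D.Equiv.trans q′ r′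
    }
  ; ∘-resp-≈  = λ (q , q′) (r , r′) → C.∘-resp-≈ q r , D.∘-resp-≈ q′ r′
  ; assoc     = C.assoc , D.assoc
  ; identityˡ = C.identityˡ , D.identityˡ
  ; identityʳ = C.identityʳ , D.identityʳ
  }
  where
  module C = Category C
  module D = Category D

record Functor (C : Category o ℓ e) (D : Category o′ ℓ′ e′) :
               Set (o ⊔ ℓ ⊔ e ⊔ o′ ⊔ ℓ′ ⊔ e′) where
  private
    module C = Category C
    module D = Category D
  field
    F₀ : C.Obj → D.Obj
    F₁ : ∀ {A B} → A C.⇒ B → F₀ A D.⇒ F₀ B
    F-resp-≈     : ∀ {A B} {f g : A C.⇒ B} → f C.≈ g → F₁ f D.≈ F₁ g
    identity     : ∀ {A} → F₁ (C.id {A}) D.≈ D.id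
    homomorphism : ∀ {X Y Z} {f : X C.⇒ Y} {g : Y C.⇒ Z} →
                   F₁ (g C.∘ f) D.≈ F₁ g D.∘ F₁ f

  F-resp-≈ʰ : ∀ {A B A′ B′} {f : A C.⇒ B} {g : A′ C.⇒ B′} → f C.≈ʰ g → F₁ f D.≈ʰ F₁ g
  F-resp-≈ʰ (C.≈⇒≈ʰ q) = D.≈⇒≈ʰ (F-resp-≈ q)

idF : {C : Category o ℓ e} → Functor C C
idF {C = C} = record
  { F₀           = λ A → A
  ; F₁           = λ f → f
  ; F-resp-≈     = λ q → q
  ; identity     = Category.Equiv.refl C
  ; homomorphism = Category.Equiv.refl C
  }

infixr 9 _∘F_

_∘F_ : {C : Category o ℓ e} {D : Category o′ ℓ′ e′} {E : Category o″ ℓ″ e″} →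
       Functor D E → Functor C D → Functor C E
_∘F_ {E = E} G F = record
  { F₀           = λ A → G.F₀ (F.F₀ A)
  ; F₁           = λ f → G.F₁ (F.F₁ f)
  ; F-resp-≈     = λ q → G.F-resp-≈ (F.F-resp-≈ q)
  ; identity     = E.trans (G.F-resp-≈ F.identity) G.identity
  ; homomorphism = E.trans (G.F-resp-≈ F.homomorphism) G.homomorphism
  }
  where
  module F = Functor F
  module G = Functor G
  module E = Category.Equiv E

-- Strict equality of functors, i.e. equality of morphisms in Cat.
infix 4 _≡F_

record _≡F_ {C : Category o ℓ e} {D : Category o′ ℓ′ e′} (F G : Functor C D) :
            Set (o ⊔ ℓ ⊔ o′ ⊔ ℓ′ ⊔ e′) where
  private
    module C = Category C
    module D = Category D
    module F = Functor F
    module G = Functor G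
  field
    eq₀ : ∀ X → F.F₀ X ≡ G.F₀ X
    eq₁ : ∀ {X Y} (f : X C.⇒ Y) → F.F₁ f D.≈ʰ G.F₁ f

record NaturalTransformation {C : Category o ℓ e} {D : Category o′ ℓ′ e′}
                             (F G : Functor C D) : Set (o ⊔ ℓ ⊔ ℓ′ ⊔ e′) where
  private
    module C = Category C
    module D = Category D
    module F = Functor F
    module G = Functor G
  field
    component : ∀ X → F.F₀ X D.⇒ G.F₀ X
    natural   : ∀ {X Y} (f : X C.⇒ Y) →
                component Y D.∘ F.F₁ f D.≈ G.F₁ f D.∘ component X

-- The square  F ∘ P₁ = G ∘ P₂  is a pullback with respect to test
-- categories of levels a, b, c.
record IsPullback (a b c : Level)
                  {P : Category o ℓ e} {A : Category o′ ℓ′ e′}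
                  {B : Category o″ ℓ″ e″} {C : Category o‴ ℓ‴ e‴}
                  (P₁ : Functor P A) (P₂ : Functor P B)
                  (F : Functor A C) (G : Functor B C) :
                  Set (suc (a ⊔ b ⊔ c) ⊔ o ⊔ ℓ ⊔ e ⊔ o′ ⊔ ℓ′ ⊔ e′ ⊔
                       o″ ⊔ ℓ″ ⊔ e″ ⊔ o‴ ⊔ ℓ‴ ⊔ e‴) where
  field
    commute : (F ∘F P₁) ≡F (G ∘F P₂)
    universal : {X : Category a b c} (H₁ : Functor X A) (H₂ : Functor X B) →
                (F ∘F H₁) ≡F (G ∘F H₂) → Functor X P
    P₁∘universal : {X : Category a b c} (H₁ : Functor X A) (H₂ : Functor X B)
                   (q : (F ∘F H₁) ≡F (G ∘F H₂)) →
                   (P₁ ∘F universal H₁ H₂ q) ≡F H₁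
    P₂∘universal : {X : Category a b c} (H₁ : Functor X A) (H₂ : Functor X B)
                   (q : (F ∘F H₁) ≡F (G ∘F H₂)) →
                   (P₂ ∘F universal H₁ H₂ q) ≡F H₂
    unique : {X : Category a b c} (H₁ : Functor X A) (H₂ : Functor X B)
             (q : (F ∘F H₁) ≡F (G ∘F H₂)) (H : Functor X P) →
             (P₁ ∘F H) ≡F H₁ → (P₂ ∘F H) ≡F H₂ → H ≡F universal H₁ H₂ q

module _ {ℰ : Category o ℓ e} {ℬ : Category o′ ℓ′ e′} (p : Functor ℰ ℬ) where
  private
    module ℰ = Category ℰ
    module ℬ = Category ℬ
    module p = Functor p

  record IsCartesian {X Y : ℰ.Obj} (f : X ℰ.⇒ Y) : Set (o ⊔ ℓ ⊔ e ⊔ ℓ′ ⊔ e′) where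
    field
      factor : ∀ {Z} (g : Z ℰ.⇒ Y) (w : p.F₀ Z ℬ.⇒ p.F₀ X) →
               p.F₁ f ℬ.∘ w ℬ.≈ p.F₁ g → Z ℰ.⇒ X
      factor-above : ∀ {Z} (g : Z ℰ.⇒ Y) (w : p.F₀ Z ℬ.⇒ p.F₀ X)
                     (q : p.F₁ f ℬ.∘ w ℬ.≈ p.F₁ g) → p.F₁ (factor g w q) ℬ.≈ w
      factor-commutes : ∀ {Z} (g : Z ℰ.⇒ Y) (w : p.F₀ Z ℬ.⇒ p.F₀ X)
                        (q : p.F₁ f ℬ.∘ w ℬ.≈ p.F₁ g) → f ℰ.∘ factor g w q ℰ.≈ g
      factor-unique : ∀ {Z} (g : Z ℰ.⇒ Y) (w : p.F₀ Z ℬ.⇒ p.F₀ X)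
                      (q : p.F₁ f ℬ.∘ w ℬ.≈ p.F₁ g) (h : Z ℰ.⇒ X) →
                      p.F₁ h ℬ.≈ w → f ℰ.∘ h ℰ.≈ g → h ℰ.≈ factor g w q

  -- The field `above` entails that  p.F₀ dom  and  K  are equal objects.
  record CartesianLift {K : ℬ.Obj} {X : ℰ.Obj} (u : K ℬ.⇒ p.F₀ X) :
                       Set (o ⊔ ℓ ⊔ e ⊔ ℓ′ ⊔ e′) where
    field
      dom       : ℰ.Obj
      lift      : dom ℰ.⇒ X
      above     : p.F₁ lift ℬ.≈ʰ u
      cartesian : IsCartesian lift

  IsFibration : Set (o ⊔ ℓ ⊔ e ⊔ o′ ⊔ ℓ′ ⊔ e′)
  IsFibration = ∀ {K X} (u : K ℬ.⇒ p.F₀ X) → CartesianLift u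

record Monad (C : Category o ℓ e) : Set (o ⊔ ℓ ⊔ e) where
  private module C = Category C
  field
    T    : Functor C C
    unit : NaturalTransformation idF T
    mult : NaturalTransformation (T ∘F T) T

  open Functor T public using () renaming (F₀ to T₀; F₁ to T₁)
  open NaturalTransformation unit public using ()
    renaming (component to η; natural to η-natural)
  open NaturalTransformation mult public using ()
    renaming (component to μ; natural to μ-natural)

  field
    μ-assoc     : ∀ {X} → μ X C.∘ T₁ (μ X) C.≈ μ X C.∘ μ (T₀ X)
    μ-identityˡ : ∀ {X} → μ X C.∘ T₁ (η X) C.≈ C.id
    μ-identityʳ : ∀ {X} → μ X C.∘ η (T₀ X) C.≈ C.id

module _ {C : Category o ℓ e} (M : Monad C) where
  private
    module M = Monad M
    module T = Functor M.T
  open Category C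
  open M using (T₀; T₁; η; μ)

  Kleisli : Category o ℓ e
  Kleisli = record
    { Obj       = Obj
    ; _⇒_       = λ K L → K ⇒ T₀ L
    ; _≈_       = _≈_
    ; id        = λ {A} → η A
    ; _∘_       = λ {_} {_} {L} g f → μ L ∘ (T₁ g ∘ f)
    ; equiv     = equiv
    ; ∘-resp-≈  = λ q r → ∘-resp-≈ Equiv.refl (∘-resp-≈ (T.F-resp-≈ q) r)
    ; assoc     = λ {_} {_} {_} {_} {f} {g} {h} → kleisli-assoc f g h
    ; identityˡ = Equiv.trans (Equiv.sym assoc)
                    (Equiv.trans (∘-resp-≈ M.μ-identityˡ Equiv.refl) identityˡ)
    ; identityʳ = λ {A} {B} {f} →
                    Equiv.trans (∘-resp-≈ Equiv.refl (Equiv.sym (M.η-natural f)))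
                      (Equiv.trans (Equiv.sym assoc)
                        (Equiv.trans (∘-resp-≈ M.μ-identityʳ Equiv.refl) identityˡ))
    }
    where
    kleisli-assoc : ∀ {A B C D} (f : A ⇒ T₀ B) (g : B ⇒ T₀ C) (h : C ⇒ T₀ D) →
                    μ D ∘ (T₁ (μ D ∘ (T₁ h ∘ g)) ∘ f) ≈ μ D ∘ (T₁ h ∘ (μ C ∘ (T₁ g ∘ f)))
    kleisli-assoc {A} {B} {C} {D} f g h = begin
      μ D ∘ (T₁ (μ D ∘ (T₁ h ∘ g)) ∘ f)
        ≈⟨ ∘-resp-≈ Equiv.refl (∘-resp-≈ T.homomorphism Equiv.refl) ⟩
      μ D ∘ ((T₁ (μ D) ∘ T₁ (T₁ h ∘ g)) ∘ f)
        ≈⟨ ∘-resp-≈ Equiv.refl assoc ⟩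
      μ D ∘ (T₁ (μ D) ∘ (T₁ (T₁ h ∘ g) ∘ f))
        ≈⟨ assoc ⟨
      (μ D ∘ T₁ (μ D)) ∘ (T₁ (T₁ h ∘ g) ∘ f)
        ≈⟨ ∘-resp-≈ M.μ-assoc (∘-resp-≈ T.homomorphism Equiv.refl) ⟩
      (μ D ∘ μ (T₀ D)) ∘ ((T₁ (T₁ h) ∘ T₁ g) ∘ f)
        ≈⟨ ∘-resp-≈ Equiv.refl assoc ⟩
      (μ D ∘ μ (T₀ D)) ∘ (T₁ (T₁ h) ∘ (T₁ g ∘ f))
        ≈⟨ assoc ⟩
      μ D ∘ (μ (T₀ D) ∘ (T₁ (T₁ h) ∘ (T₁ g ∘ f)))
        ≈⟨ ∘-resp-≈ Equiv.refl assoc ⟨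
      μ D ∘ ((μ (T₀ D) ∘ T₁ (T₁ h)) ∘ (T₁ g ∘ f))
        ≈⟨ ∘-resp-≈ Equiv.refl (∘-resp-≈ (M.μ-natural h) Equiv.refl) ⟩
      μ D ∘ ((T₁ h ∘ μ C) ∘ (T₁ g ∘ f))
        ≈⟨ ∘-resp-≈ Equiv.refl assoc ⟩
      μ D ∘ (T₁ h ∘ (μ C ∘ (T₁ g ∘ f))) ∎
      where open SetoidReasoning (homSetoid A (T₀ D))

  KleisliLeftAdjoint : Functor C Kleisli
  KleisliLeftAdjoint = record
    { F₀           = λ A → A
    ; F₁           = λ {_} {B} f → η B ∘ f
    ; F-resp-≈     = ∘-resp-≈ Equiv.refl
    ; identity     = identityʳ
    ; homomorphism = λ {_} {_} {_} {f} {g} → hom f g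
    }
    where
    hom : ∀ {X Y Z} (f : X ⇒ Y) (g : Y ⇒ Z) →
          η Z ∘ (g ∘ f) ≈ μ Z ∘ (T₁ (η Z ∘ g) ∘ (η Y ∘ f))
    hom {X} {Y} {Z} f g = Equiv.sym (begin
      μ Z ∘ (T₁ (η Z ∘ g) ∘ (η Y ∘ f))
        ≈⟨ ∘-resp-≈ Equiv.refl (∘-resp-≈ T.homomorphism Equiv.refl) ⟩
      μ Z ∘ ((T₁ (η Z) ∘ T₁ g) ∘ (η Y ∘ f))
        ≈⟨ ∘-resp-≈ Equiv.refl assoc ⟩
      μ Z ∘ (T₁ (η Z) ∘ (T₁ g ∘ (η Y ∘ f)))
        ≈⟨ assoc ⟨
      (μ Z ∘ T₁ (η Z)) ∘ (T₁ g ∘ (η Y ∘ f))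
        ≈⟨ ∘-resp-≈ M.μ-identityˡ Equiv.refl ⟩
      id ∘ (T₁ g ∘ (η Y ∘ f))
        ≈⟨ identityˡ ⟩
      T₁ g ∘ (η Y ∘ f)
        ≈⟨ assoc ⟨
      (T₁ g ∘ η Y) ∘ f
        ≈⟨ ∘-resp-≈ (M.η-natural g) Equiv.refl ⟨
      (η Z ∘ g) ∘ f
        ≈⟨ assoc ⟩
      η Z ∘ (g ∘ f) ∎)
      where open SetoidReasoning (homSetoid X (T₀ Z))

record FibredMonad {ℰ : Category o ℓ e} {ℬ : Category o′ ℓ′ e′} (p : Functor ℰ ℬ) :
                   Set (o ⊔ ℓ ⊔ e ⊔ o′ ⊔ ℓ′ ⊔ e′) where
  private
    module ℰ = Category ℰ
    module ℬ = Category ℬ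
    module p = Functor p
  field
    𝕋 : Monad ℬ
    𝕋̃ : Monad ℰ

  module 𝕋 = Monad 𝕋
  module 𝕋̃ = Monad 𝕋̃

  field
    p-T : (p ∘F 𝕋̃.T) ≡F (𝕋.T ∘F p)
    p-η : ∀ X → p.F₁ (𝕋̃.η X) ℬ.≈ʰ 𝕋.η (p.F₀ X)
    p-μ : ∀ X → p.F₁ (𝕋̃.μ X) ℬ.≈ʰ 𝕋.μ (p.F₀ X)
    T̃-preserves-cartesian : ∀ {X Y} {f : X ℰ.⇒ Y} → IsCartesian p f → IsCartesian p (𝕋̃.T₁ f)
    η̃-cartesian : ∀ X → IsCartesian p (𝕋̃.η X)
    μ̃-cartesian : ∀ X → IsCartesian p (𝕋̃.μ X)

  open _≡F_ p-T public using () renaming (eq₀ to p-T₀; eq₁ to p-T₁)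

  J : Functor ℬ (Kleisli 𝕋)
  J = KleisliLeftAdjoint 𝕋

  J̃ : Functor ℰ (Kleisli 𝕋̃)
  J̃ = KleisliLeftAdjoint 𝕋̃

  p_T : Functor (Kleisli 𝕋̃) (Kleisli 𝕋)
  p_T = record
    { F₀           = p.F₀
    ; F₁           = F₁
    ; F-resp-≈     = λ {_} {_} {f} {g} q → ℬ.≈ʰ⇒≈
                       (ℬ.≈ʰ-trans (F₁-≈ʰ f)
                         (ℬ.≈ʰ-trans (ℬ.≈⇒≈ʰ (p.F-resp-≈ q)) (ℬ.≈ʰ-sym (F₁-≈ʰ g))))
    ; identity     = λ {A} → ℬ.≈ʰ⇒≈ (ℬ.≈ʰ-trans (F₁-≈ʰ (𝕋̃.η A)) (p-η A))
    ; homomorphism = λ {_} {_} {Z} {f} {g} → ℬ.≈ʰ⇒≈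
        (ℬ.≈ʰ-trans (F₁-≈ʰ (𝕋̃.μ Z ℰ.∘ (𝕋̃.T₁ g ℰ.∘ f)))
          (ℬ.≈ʰ-trans (ℬ.≈⇒≈ʰ p.homomorphism)
            (ℬ.∘-resp-≈ʰ (p-μ Z)
              (ℬ.≈ʰ-trans (ℬ.≈⇒≈ʰ p.homomorphism)
                (ℬ.∘-resp-≈ʰ (T₁-F₁ g) (ℬ.≈ʰ-sym (F₁-≈ʰ f)))))))
    }
    where
    -- p f, with its codomain p (T̃ Y) replaced by the equal object T (p Y).
    F₁ : ∀ {X Y} → X ℰ.⇒ 𝕋̃.T₀ Y → p.F₀ X ℬ.⇒ 𝕋.T₀ (p.F₀ Y)
    F₁ {X} {Y} f = subst (p.F₀ X ℬ.⇒_) (p-T₀ Y) (p.F₁ f)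

    F₁-≈ʰ : ∀ {X Y} (f : X ℰ.⇒ 𝕋̃.T₀ Y) → F₁ f ℬ.≈ʰ p.F₁ f
    F₁-≈ʰ {Y = Y} f = ℬ.subst-cod-≈ʰ (p-T₀ Y) (p.F₁ f)

    T₁-F₁ : ∀ {X Y} (f : X ℰ.⇒ 𝕋̃.T₀ Y) → p.F₁ (𝕋̃.T₁ f) ℬ.≈ʰ 𝕋.T₁ (F₁ f)
    T₁-F₁ f = ℬ.≈ʰ-trans (p-T₁ f) (Functor.F-resp-≈ʰ 𝕋.T (ℬ.≈ʰ-sym (F₁-≈ʰ f)))

record Monoidal (C : Category o ℓ e) : Set (o ⊔ ℓ ⊔ e) where
  open Category C
  infixr 10 _⊗₀_ _⊗₁_
  field
    ⊗ : Functor (Product C C) C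
    I : Obj

  _⊗₀_ : Obj → Obj → Obj
  X ⊗₀ Y = Functor.F₀ ⊗ (X , Y)

  _⊗₁_ : ∀ {X X′ Y Y′} → X ⇒ X′ → Y ⇒ Y′ → X ⊗₀ Y ⇒ X′ ⊗₀ Y′
  f ⊗₁ g = Functor.F₁ ⊗ (f , g)

  field
    λ⇒ : ∀ X → I ⊗₀ X ⇒ X
    ρ⇒ : ∀ X → X ⊗₀ I ⇒ X
    α⇒ : ∀ X Y Z → (X ⊗₀ Y) ⊗₀ Z ⇒ X ⊗₀ (Y ⊗₀ Z)

    λ-iso : ∀ X → IsIso (λ⇒ X)
    ρ-iso : ∀ X → IsIso (ρ⇒ X)
    α-iso : ∀ X Y Z → IsIso (α⇒ X Y Z)

    λ-natural : ∀ {X Y} (f : X ⇒ Y) → λ⇒ Y ∘ (id ⊗₁ f) ≈ f ∘ λ⇒ X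
    ρ-natural : ∀ {X Y} (f : X ⇒ Y) → ρ⇒ Y ∘ (f ⊗₁ id) ≈ f ∘ ρ⇒ X
    α-natural : ∀ {X X′ Y Y′ Z Z′} (f : X ⇒ X′) (g : Y ⇒ Y′) (h : Z ⇒ Z′) →
                α⇒ X′ Y′ Z′ ∘ ((f ⊗₁ g) ⊗₁ h) ≈ (f ⊗₁ (g ⊗₁ h)) ∘ α⇒ X Y Z

    triangle : ∀ X Y → (id ⊗₁ λ⇒ Y) ∘ α⇒ X I Y ≈ ρ⇒ X ⊗₁ id
    pentagon : ∀ W X Y Z →
               (id ⊗₁ α⇒ X Y Z) ∘ (α⇒ W (X ⊗₀ Y) Z ∘ (α⇒ W X Y ⊗₁ id)) ≈
               α⇒ W X (Y ⊗₀ Z) ∘ α⇒ (W ⊗₀ X) Y Z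

record IsStrictMonoidal {C : Category o ℓ e} {D : Category o′ ℓ′ e′}
                        (𝒞 : Monoidal C) (𝒟 : Monoidal D) (F : Functor C D) :
                        Set (o ⊔ ℓ ⊔ o′ ⊔ ℓ′ ⊔ e′) where
  private
    module C = Category C
    module D = Category D
    module 𝒞 = Monoidal 𝒞
    module 𝒟 = Monoidal 𝒟
  open Functor F using (F₀; F₁)
  field
    F-I  : F₀ 𝒞.I ≡ 𝒟.I
    F-⊗₀ : ∀ X Y → F₀ (X 𝒞.⊗₀ Y) ≡ F₀ X 𝒟.⊗₀ F₀ Y
    F-⊗₁ : ∀ {X X′ Y Y′} (f : X C.⇒ X′) (g : Y C.⇒ Y′) →
           F₁ (f 𝒞.⊗₁ g) D.≈ʰ F₁ f 𝒟.⊗₁ F₁ g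
    F-λ  : ∀ X → F₁ (𝒞.λ⇒ X) D.≈ʰ 𝒟.λ⇒ (F₀ X)
    F-ρ  : ∀ X → F₁ (𝒞.ρ⇒ X) D.≈ʰ 𝒟.ρ⇒ (F₀ X)
    F-α  : ∀ X Y Z → F₁ (𝒞.α⇒ X Y Z) D.≈ʰ 𝒟.α⇒ (F₀ X) (F₀ Y) (F₀ Z)

record Strength {C : Category o ℓ e} (𝒞 : Monoidal C) (M : Monad C) : Set (o ⊔ ℓ ⊔ e) where
  open Category C
  open Monoidal 𝒞
  open Monad M
  field
    t : ∀ A B → A ⊗₀ T₀ B ⇒ T₀ (A ⊗₀ B)
    t-natural : ∀ {A A′ B B′} (f : A ⇒ A′) (g : B ⇒ B′) →
                t A′ B′ ∘ (f ⊗₁ T₁ g) ≈ T₁ (f ⊗₁ g) ∘ t A B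
    t-λ : ∀ B → T₁ (λ⇒ B) ∘ t I B ≈ λ⇒ (T₀ B)
    t-α : ∀ A B C → T₁ (α⇒ A B C) ∘ t (A ⊗₀ B) C ≈
                    t A (B ⊗₀ C) ∘ ((id ⊗₁ t B C) ∘ α⇒ A B (T₀ C))
    t-η : ∀ A B → t A B ∘ (id ⊗₁ η B) ≈ η (A ⊗₀ B)
    t-μ : ∀ A B → t A B ∘ (id ⊗₁ μ B) ≈ μ (A ⊗₀ B) ∘ (T₁ (t A B) ∘ t A (T₀ B))

record RawAction {M : Category o ℓ e} (ℳ : Monoidal M) (C : Category o′ ℓ′ e′) :
                 Set (o ⊔ ℓ ⊔ o′ ⊔ ℓ′) where
  private
    module M = Category M
    module C = Category C
  open Monoidal ℳ using (I; _⊗₀_)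
  infixr 10 _·₀_ _·₁_
  field
    _·₀_ : M.Obj → C.Obj → C.Obj
    _·₁_ : ∀ {m m′ c c′} → m M.⇒ m′ → c C.⇒ c′ → (m ·₀ c) C.⇒ (m′ ·₀ c′)
    ηᵃ   : ∀ c → (I ·₀ c) C.⇒ c
    μᵃ   : ∀ m₁ m₂ c → ((m₁ ⊗₀ m₂) ·₀ c) C.⇒ (m₁ ·₀ (m₂ ·₀ c))

record IsAction {M : Category o ℓ e} {ℳ : Monoidal M} {C : Category o′ ℓ′ e′}
                (A : RawAction ℳ C) : Set (o ⊔ ℓ ⊔ e ⊔ o′ ⊔ ℓ′ ⊔ e′) where
  private
    module M = Category M
  open Category C
  open Monoidal ℳ
  open RawAction A
  field
    ·-resp-≈ : ∀ {m m′ c c′} {f f′ : m M.⇒ m′} {g g′ : c ⇒ c′} →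
               f M.≈ f′ → g ≈ g′ → f ·₁ g ≈ f′ ·₁ g′
    ·-identity : ∀ {m c} → M.id {m} ·₁ id {c} ≈ id
    ·-homomorphism : ∀ {m m′ m″ c c′ c″} {f : m M.⇒ m′} {f′ : m′ M.⇒ m″}
                     {g : c ⇒ c′} {g′ : c′ ⇒ c″} →
                     (f′ M.∘ f) ·₁ (g′ ∘ g) ≈ (f′ ·₁ g′) ∘ (f ·₁ g)

    ηᵃ-iso     : ∀ c → IsIso (ηᵃ c)
    ηᵃ-natural : ∀ {c c′} (g : c ⇒ c′) → ηᵃ c′ ∘ (M.id ·₁ g) ≈ g ∘ ηᵃ c
    μᵃ-iso     : ∀ m₁ m₂ c → IsIso (μᵃ m₁ m₂ c)
    μᵃ-natural : ∀ {m₁ m₁′ m₂ m₂′ c c′} (f₁ : m₁ M.⇒ m₁′) (f₂ : m₂ M.⇒ m₂′) (g : c ⇒ c′) →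
                 μᵃ m₁′ m₂′ c′ ∘ ((f₁ ⊗₁ f₂) ·₁ g) ≈ (f₁ ·₁ (f₂ ·₁ g)) ∘ μᵃ m₁ m₂ c

    -- The law  ηᵃ (m · c) ∘ μᵃ I m c ≈ λ⇒ m · id  follows from these two.
    μᵃ-coherence : ∀ m₁ m₂ m₃ c →
                   μᵃ m₁ m₂ (m₃ ·₀ c) ∘ μᵃ (m₁ ⊗₀ m₂) m₃ c ≈
                   (M.id ·₁ μᵃ m₂ m₃ c) ∘ (μᵃ m₁ (m₂ ⊗₀ m₃) c ∘ (α⇒ m₁ m₂ m₃ ·₁ id))
    ηᵃ-coherence : ∀ m c → (M.id ·₁ ηᵃ c) ∘ μᵃ m I c ≈ ρ⇒ m ·₁ id

record StrictlyPreserves {M : Category o ℓ e} {ℳ : Monoidal M}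
                         {C : Category o′ ℓ′ e′} {D : Category o″ ℓ″ e″}
                         (A : RawAction ℳ C) (B : RawAction ℳ D) (F : Functor C D) :
                         Set (o ⊔ ℓ ⊔ o′ ⊔ ℓ′ ⊔ o″ ⊔ ℓ″ ⊔ e″) where
  private
    module M = Category M
    module C = Category C
    module D = Category D
    module A = RawAction A
    module B = RawAction B
  open Functor F using (F₀; F₁)
  field
    pres-·₀ : ∀ m c → F₀ (m A.·₀ c) ≡ m B.·₀ F₀ c
    pres-·₁ : ∀ {m m′ c c′} (f : m M.⇒ m′) (g : c C.⇒ c′) →
              F₁ (f A.·₁ g) D.≈ʰ f B.·₁ F₁ g
    pres-η  : ∀ c → F₁ (A.ηᵃ c) D.≈ʰ B.ηᵃ (F₀ c)
    pres-μ  : ∀ m₁ m₂ c → F₁ (A.μᵃ m₁ m₂ c) D.≈ʰ B.μᵃ m₁ m₂ (F₀ c)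

kleisliAction : {C : Category o ℓ e} (𝒞 : Monoidal C) (M : Monad C) →
                Strength 𝒞 M → RawAction 𝒞 (Kleisli M)
kleisliAction {C = C} 𝒞 M s = record
  { _·₀_ = _⊗₀_
  ; _·₁_ = λ {_} {m′} {_} {c′} f g → t m′ c′ ∘ (f ⊗₁ g)
  ; ηᵃ   = λ c → J.F₁ (λ⇒ c)
  ; μᵃ   = λ m₁ m₂ c → J.F₁ (α⇒ m₁ m₂ c)
  }
  where
  open Category C
  open Monoidal 𝒞
  open Strength s
  module J = Functor (KleisliLeftAdjoint M)

-- The structure isomorphisms of A are transported along F I ≡ I and
-- F (m₁ ⊗ m₂) ≡ F m₁ ⊗ F m₂.
changeOfBase : {M : Category o ℓ e} {N : Category o′ ℓ′ e′} {C : Category o″ ℓ″ e″}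
               {ℳ : Monoidal M} {𝒩 : Monoidal N} {F : Functor M N} →
               IsStrictMonoidal ℳ 𝒩 F → RawAction 𝒩 C → RawAction ℳ C
changeOfBase {C = C} {F = F} sm A = record
  { _·₀_ = λ m c → F₀ m ·₀ c
  ; _·₁_ = λ f g → F₁ f ·₁ g
  ; ηᵃ   = λ c → subst (λ i → (i ·₀ c) ⇒ c) (sym F-I) (ηᵃ c)
  ; μᵃ   = λ m₁ m₂ c → subst (λ x → (x ·₀ c) ⇒ (F₀ m₁ ·₀ (F₀ m₂ ·₀ c)))
                             (sym (F-⊗₀ m₁ m₂)) (μᵃ (F₀ m₁) (F₀ m₂) c)
  }
  where
  open Category C using (_⇒_)
  open Functor F using (F₀; F₁)
  open IsStrictMonoidal sm
  open RawAction A

StrengthAbove : {ℰ : Category o ℓ e} {ℬ : Category o′ ℓ′ e′} {p : Functor ℰ ℬ}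
                {mℰ : Monoidal ℰ} {mℬ : Monoidal ℬ} (𝕄 : FibredMonad p) →
                Strength mℰ (FibredMonad.𝕋̃ 𝕄) → Strength mℬ (FibredMonad.𝕋 𝕄) →
                Set (o ⊔ ℓ′ ⊔ e′)
StrengthAbove {ℬ = ℬ} {p = p} 𝕄 s̃ s =
  ∀ X Y → p.F₁ (s̃.t X Y) ℬ.≈ʰ s.t (p.F₀ X) (p.F₀ Y)
  where
  module ℬ = Category ℬ
  module p = Functor p
  module s̃ = Strength s̃
  module s = Strength s

{-# OPTIONS --safe #-}
module Submission where

-- A p-cartesian f : Y → T̃ X is p_T-cartesian as a Kleisli morphism, because
-- factoring through f in ℰ_T̃ means factoring through μ̃ ∘ T̃ f in ℰ, which is
-- p-cartesian; hence p_T inherits its lifts from p.  Similarly, since η̃ is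
-- cartesian, a Kleisli morphism whose image under p_T factors through η comes
-- from a unique morphism of ℰ, which is the universal property of the square.
-- The laws of the actions on the Kleisli categories reduce, along J, to the
-- monoidal laws and the axioms of the strength.

open import Defs
open import Data.Product using (_×_; _,_)
open import Level using (Level)
open import Relation.Binary.PropositionalEquality using (_≡_; refl; sym; trans; cong; subst)
import Relation.Binary.Reasoning.Setoid as SetoidReasoning

private
  variable
    o ℓ e o′ ℓ′ e′ o″ ℓ″ e″ : Level

-- Equality of morphisms along equal objects

module CategoryProperties (C : Category o ℓ e) where
  open Category C

  module HomReasoning {A B : Obj} = SetoidReasoning (homSetoid A B)

  infixr 4 _⟩∘⟨_ refl⟩∘⟨_
  infixl 5 _⟩∘⟨refl
  infixr 3 _⊙_

  _⟩∘⟨_ : ∀ {A B C} {g g′ : B ⇒ C} {f f′ : A ⇒ B} → g ≈ g′ → f ≈ f′ → g ∘ f ≈ g′ ∘ f′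
  _⟩∘⟨_ = ∘-resp-≈

  refl⟩∘⟨_ : ∀ {A B C} {g : B ⇒ C} {f f′ : A ⇒ B} → f ≈ f′ → g ∘ f ≈ g ∘ f′
  refl⟩∘⟨_ = ∘-resp-≈ Equiv.refl

  _⟩∘⟨refl : ∀ {A B C} {g g′ : B ⇒ C} {f : A ⇒ B} → g ≈ g′ → g ∘ f ≈ g′ ∘ f
  q ⟩∘⟨refl = ∘-resp-≈ q Equiv.refl

  _⊙_ : ∀ {A B C D A′ B′} {f : A ⇒ B} {g : C ⇒ D} {h : A′ ⇒ B′} → f ≈ʰ g → g ≈ʰ h → f ≈ʰ h
  _⊙_ = ≈ʰ-trans

  -- Needed wherever strictness holds only up to `≡`: components such as `η` or `μᵃ` at two provably
  -- equal objects have different types, so `≈` cannot compare them.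
  family-≈ʰ : ∀ {i} {I : Set i} {S T : I → Obj} (φ : ∀ x → S x ⇒ T x) →
              ∀ {x y} → x ≡ y → φ x ≈ʰ φ y
  family-≈ʰ φ refl = ≈ʰ-refl

  subst-dom-≈ʰ : ∀ {i} {I : Set i} (S : I → Obj) {B x y} (q : x ≡ y) (f : S x ⇒ B) →
                 subst (λ z → S z ⇒ B) q f ≈ʰ f
  subst-dom-≈ʰ S refl f = ≈ʰ-refl

  subst-dom-iso : ∀ {i} {I : Set i} (S : I → Obj) {B x y} (q : x ≡ y) {f : S x ⇒ B} →
                  IsIso f → IsIso (subst (λ z → S z ⇒ B) q f)
  subst-dom-iso S refl iso = iso

  cast : ∀ {A B A′ B′} → A ≡ A′ → B ≡ B′ → A ⇒ B → A′ ⇒ B′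
  cast refl refl f = f

  cast-≈ʰ : ∀ {A B A′ B′} (q : A ≡ A′) (r : B ≡ B′) (f : A ⇒ B) → cast q r f ≈ʰ f
  cast-≈ʰ refl refl f = ≈ʰ-refl

module _ {C : Category o ℓ e} {D : Category o′ ℓ′ e′} (F : Functor C D) where
  private
    module C = Category C
    module D = Category D
    module F = Functor F

  F-resp-iso : ∀ {A B} {f : A C.⇒ B} → C.IsIso f → D.IsIso (F.F₁ f)
  F-resp-iso iso = record
    { inv  = F.F₁ inv
    ; isoˡ = D.Equiv.trans (D.Equiv.sym F.homomorphism) (D.Equiv.trans (F.F-resp-≈ isoˡ) F.identity)
    ; isoʳ = D.Equiv.trans (D.Equiv.sym F.homomorphism) (D.Equiv.trans (F.F-resp-≈ isoʳ) F.identity)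
    }
    where open C.IsIso iso

-- Composition in the Kleisli category

module KleisliProperties {C : Category o ℓ e} (M : Monad C) where
  open Category C
  open CategoryProperties C
  open Monad M
  private
    module K = Category (Kleisli M)
    module J = Functor (KleisliLeftAdjoint M)
    module T = Functor T

  K-≈ʰ⇒≈ʰ : ∀ {A B A′ B′} {f : A ⇒ T₀ B} {g : A′ ⇒ T₀ B′} → K._≈ʰ_ {A} {B} f {A′} {B′} g → f ≈ʰ g
  K-≈ʰ⇒≈ʰ (K.≈⇒≈ʰ q) = ≈⇒≈ʰ q

  -- The equality of Kleisli codomains is a separate argument because `f ≈ʰ g` only yields
  -- `T₀ B ≡ T₀ B′`, and `T₀` need not be injective.
  ≈ʰ⇒K-≈ʰ : ∀ {A B A′ B′} {f : A ⇒ T₀ B} {g : A′ ⇒ T₀ B′} → B ≡ B′ → f ≈ʰ g →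
            K._≈ʰ_ {A} {B} f {A′} {B′} g
  ≈ʰ⇒K-≈ʰ refl (≈⇒≈ʰ q) = K.≈⇒≈ʰ q

  -- The unit inserted by `J` is absorbed by `μ` through `μ-identityˡ`. With `∘ᴷ-J`, this turns
  -- naturality squares of Kleisli maps into equations in `C`.
  J-∘ᴷ : ∀ {A B C} (h : B ⇒ C) (f : A ⇒ T₀ B) → J.F₁ h K.∘ f ≈ T₁ h ∘ f
  J-∘ᴷ {A} {B} {C} h f = begin
    μ C ∘ (T₁ (η C ∘ h) ∘ f)      ≈⟨ refl⟩∘⟨ (T.homomorphism ⟩∘⟨refl) ⟩
    μ C ∘ ((T₁ (η C) ∘ T₁ h) ∘ f) ≈⟨ refl⟩∘⟨ assoc ⟩
    μ C ∘ (T₁ (η C) ∘ (T₁ h ∘ f)) ≈⟨ assoc ⟨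
    (μ C ∘ T₁ (η C)) ∘ (T₁ h ∘ f) ≈⟨ μ-identityˡ ⟩∘⟨refl ⟩
    id ∘ (T₁ h ∘ f)               ≈⟨ identityˡ ⟩
    T₁ h ∘ f                      ∎
    where open HomReasoning

  -- Naturality moves `η` past `g`, where `μ-identityʳ` cancels it.
  ∘ᴷ-J : ∀ {A B C} (g : B ⇒ T₀ C) (h : A ⇒ B) → g K.∘ J.F₁ h ≈ g ∘ h
  ∘ᴷ-J {A} {B} {C} g h = begin
    μ C ∘ (T₁ g ∘ (η B ∘ h)) ≈⟨ refl⟩∘⟨ assoc ⟨
    μ C ∘ ((T₁ g ∘ η B) ∘ h) ≈⟨ refl⟩∘⟨ (η-natural g ⟩∘⟨refl) ⟨
    μ C ∘ ((η (T₀ C) ∘ g) ∘ h) ≈⟨ assoc ⟨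
    (μ C ∘ (η (T₀ C) ∘ g)) ∘ h ≈⟨ assoc ⟩∘⟨refl ⟨
    ((μ C ∘ η (T₀ C)) ∘ g) ∘ h ≈⟨ (μ-identityʳ ⟩∘⟨refl) ⟩∘⟨refl ⟩
    (id ∘ g) ∘ h ≈⟨ identityˡ ⟩∘⟨refl ⟩
    g ∘ h ∎
    where open HomReasoning

-- Cartesian morphisms

module _ {ℰ : Category o ℓ e} {ℬ : Category o′ ℓ′ e′} (p : Functor ℰ ℬ) where
  private
    module ℰ = Category ℰ
    module ℬ = Category ℬ
    module p = Functor p

  -- Both `h` and `h′` factor `f ∘ h′` through `f` over `p h′`, so each equals the chosen factor.
  cartesian-cancel : ∀ {X Y Z} {f : X ℰ.⇒ Y} → IsCartesian p f → {h h′ : Z ℰ.⇒ X} →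
                     p.F₁ h ℬ.≈ p.F₁ h′ → f ℰ.∘ h ℰ.≈ f ℰ.∘ h′ → h ℰ.≈ h′
  cartesian-cancel {f = f} cart {h} {h′} q r = ℰ.Equiv.trans
    (factor-unique g w s h q r)
    (ℰ.Equiv.sym (factor-unique g w s h′ ℬ.Equiv.refl ℰ.Equiv.refl))
    where
    open IsCartesian cart
    g = f ℰ.∘ h′
    w = p.F₁ h′
    s = ℬ.Equiv.sym p.homomorphism

  -- Factor in two stages: through `g` over `p f ∘ w`, then the result through `f` over `w`.
  ∘-cartesian : ∀ {X Y Z} {g : Y ℰ.⇒ Z} {f : X ℰ.⇒ Y} →
                IsCartesian p g → IsCartesian p f → IsCartesian p (g ℰ.∘ f)
  ∘-cartesian {g = g} {f} cg cf = record
    { factor          = λ k w q → cf.factor (k₁ k w q) w (above k w q)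
    ; factor-above    = λ k w q → cf.factor-above (k₁ k w q) w (above k w q)
    ; factor-commutes = λ k w q → ℰ.Equiv.trans ℰ.assoc
        (ℰ.Equiv.trans
          (ℰ.∘-resp-≈ ℰ.Equiv.refl (cf.factor-commutes (k₁ k w q) w (above k w q)))
          (cg.factor-commutes k (p.F₁ f ℬ.∘ w) (split k w q)))
    ; factor-unique   = λ k w q h r s → cf.factor-unique (k₁ k w q) w (above k w q) h r
        (cg.factor-unique k (p.F₁ f ℬ.∘ w) (split k w q) (f ℰ.∘ h)
          (ℬ.Equiv.trans p.homomorphism (ℬ.∘-resp-≈ ℬ.Equiv.refl r))
          (ℰ.Equiv.trans (ℰ.Equiv.sym ℰ.assoc) s))
    }
    where
    module cg = IsCartesian cg
    module cf = IsCartesian cf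
    module _ {W} (k : W ℰ.⇒ _) (w : p.F₀ W ℬ.⇒ p.F₀ _) (q : p.F₁ (g ℰ.∘ f) ℬ.∘ w ℬ.≈ p.F₁ k) where
      split : p.F₁ g ℬ.∘ (p.F₁ f ℬ.∘ w) ℬ.≈ p.F₁ k
      split = ℬ.Equiv.trans (ℬ.Equiv.sym ℬ.assoc)
        (ℬ.Equiv.trans (ℬ.∘-resp-≈ (ℬ.Equiv.sym p.homomorphism) ℬ.Equiv.refl) q)
      k₁ = cg.factor k (p.F₁ f ℬ.∘ w) split
      above : p.F₁ f ℬ.∘ w ℬ.≈ p.F₁ k₁
      above = ℬ.Equiv.sym (cg.factor-above k (p.F₁ f ℬ.∘ w) split)

-- The fibration between Kleisli categories and the pullback square

module FibredMonadProperties {ℰ : Category o ℓ e} {ℬ : Category o′ ℓ′ e′} {p : Functor ℰ ℬ}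
                             (𝕄 : FibredMonad p) where
  open FibredMonad 𝕄
  open CategoryProperties ℬ
  open KleisliProperties 𝕋
  private
    module ℰ = Category ℰ
    module ℬ = Category ℬ
    module ℰ_T = Category (Kleisli 𝕋̃)
    module ℬ_T = Category (Kleisli 𝕋)
    module p = Functor p
    module p_T = Functor p_T
    module J = Functor J
    module J̃ = Functor J̃
    module K̃ = KleisliProperties 𝕋̃

  p_T-≈ʰ : ∀ {X Y} (f : X ℰ.⇒ 𝕋̃.T₀ Y) → p_T.F₁ f ℬ.≈ʰ p.F₁ f
  p_T-≈ʰ {Y = Y} f = ℬ.subst-cod-≈ʰ (p-T₀ Y) (p.F₁ f)

  p-J̃ : ∀ {X Y} (f : X ℰ.⇒ Y) → p.F₁ (J̃.F₁ f) ℬ.≈ʰ J.F₁ (p.F₁ f)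
  p-J̃ {Y = Y} f = ℬ.≈⇒≈ʰ p.homomorphism ⊙ ℬ.∘-resp-≈ʰ (p-η Y) ℬ.≈ʰ-refl

  p_T-J̃ : ∀ {X Y} (f : X ℰ.⇒ Y) → p_T.F₁ (J̃.F₁ f) ℬ.≈ʰ J.F₁ (p.F₁ f)
  p_T-J̃ f = p_T-≈ʰ (J̃.F₁ f) ⊙ p-J̃ f

  p-μ-T₁ : ∀ {X Y} (f : X ℰ.⇒ 𝕋̃.T₀ Y) →
           p.F₁ (𝕋̃.μ Y ℰ.∘ 𝕋̃.T₁ f) ℬ.≈ʰ 𝕋.μ (p.F₀ Y) ℬ.∘ 𝕋.T₁ (p_T.F₁ f)
  p-μ-T₁ {Y = Y} f = ℬ.≈⇒≈ʰ p.homomorphism ⊙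
    ℬ.∘-resp-≈ʰ (p-μ Y) (p-T₁ f ⊙ Functor.F-resp-≈ʰ 𝕋.T (ℬ.≈ʰ-sym (p_T-≈ʰ f)))

  p_T-cartesian : ∀ {X Y} {f : X ℰ.⇒ 𝕋̃.T₀ Y} → IsCartesian p f → IsCartesian p_T {X} {Y} f
  p_T-cartesian {X} {Y} {f} cart = record
    { factor          = λ g w q → c.factor g (w̃ w) (over g w q)
    ; factor-above    = λ g w q → ℬ.≈ʰ⇒≈
        (p_T-≈ʰ _ ⊙ ℬ.≈⇒≈ʰ (c.factor-above g (w̃ w) (over g w q)) ⊙ w̃-≈ʰ w)
    ; factor-commutes = λ g w q → ℰ.Equiv.trans (ℰ.Equiv.sym ℰ.assoc)
        (c.factor-commutes g (w̃ w) (over g w q))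
    ; factor-unique   = λ g w q h r s → c.factor-unique g (w̃ w) (over g w q) h
        (ℬ.≈ʰ⇒≈ (ℬ.≈ʰ-sym (p_T-≈ʰ h) ⊙ ℬ.≈⇒≈ʰ r ⊙ ℬ.≈ʰ-sym (w̃-≈ʰ w)))
        (ℰ.Equiv.trans ℰ.assoc s)
    }
    where
    -- Kleisli composition with `f` is, up to `assoc`, ordinary composition with this cartesian map,
    -- so its factors are the Kleisli factors.
    module c = IsCartesian (∘-cartesian p (μ̃-cartesian Y) (T̃-preserves-cartesian cart))

    -- A base map of `ℬ_T` ends in `T (p X)`, whereas factoring in `ℰ` requires one ending in
    -- `p (T̃ X)`.
    w̃ : ∀ {K} → K ℬ.⇒ 𝕋.T₀ (p.F₀ X) → K ℬ.⇒ p.F₀ (𝕋̃.T₀ X)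
    w̃ = subst (_ ℬ.⇒_) (sym (p-T₀ X))

    w̃-≈ʰ : ∀ {K} (w : K ℬ.⇒ 𝕋.T₀ (p.F₀ X)) → w̃ w ℬ.≈ʰ w
    w̃-≈ʰ = ℬ.subst-cod-≈ʰ (sym (p-T₀ X))

    over : ∀ {Z} (g : Z ℰ.⇒ 𝕋̃.T₀ Y) (w : p.F₀ Z ℬ.⇒ 𝕋.T₀ (p.F₀ X)) →
           p_T.F₁ f ℬ_T.∘ w ℬ.≈ p_T.F₁ g →
           p.F₁ (𝕋̃.μ Y ℰ.∘ 𝕋̃.T₁ f) ℬ.∘ w̃ w ℬ.≈ p.F₁ g
    over g w q = ℬ.≈ʰ⇒≈
      (ℬ.∘-resp-≈ʰ (p-μ-T₁ f) (w̃-≈ʰ w) ⊙ ℬ.≈⇒≈ʰ ℬ.assoc ⊙ ℬ.≈⇒≈ʰ q ⊙ p_T-≈ʰ g)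

  p_T-fibration : IsFibration p → IsFibration p_T
  p_T-fibration fib {K} {X} u = record
    { dom       = dom
    ; lift      = lift
    ; above     = ≈ʰ⇒K-≈ʰ refl (p_T-≈ʰ lift ⊙ above ⊙ ℬ.subst-cod-≈ʰ (sym (p-T₀ X)) u)
    ; cartesian = p_T-cartesian cartesian
    }
    where
    -- Lifting at `T̃ X` rather than at `X` makes the `p`-lift a Kleisli map into `X`.
    open CartesianLift (fib {X = 𝕋̃.T₀ X} (subst (K ℬ.⇒_) (sym (p-T₀ X)) u))

  -- A form of `cartesian-cancel` for functors that agree on objects only up to `≡`, as in the
  -- uniqueness half of the pullback.
  η̃-cancel : ∀ {A B A′ B′} {h : A ℰ.⇒ B} {h′ : A′ ℰ.⇒ B′} → A ≡ A′ → B ≡ B′ →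
             p.F₁ h ℬ.≈ʰ p.F₁ h′ → 𝕋̃.η B ℰ.∘ h ℰ.≈ʰ 𝕋̃.η B′ ℰ.∘ h′ → h ℰ.≈ʰ h′
  η̃-cancel {B = B} refl refl q r =
    ℰ.≈⇒≈ʰ (cartesian-cancel p (η̃-cartesian B) (ℬ.≈ʰ⇒≈ q) (ℰ.≈ʰ⇒≈ r))

  module Universal {𝒳 : Category o″ ℓ″ e″} (H₁ : Functor 𝒳 (Kleisli 𝕋̃)) (H₂ : Functor 𝒳 ℬ)
                   (q : (p_T ∘F H₁) ≡F (J ∘F H₂)) where
    private
      module 𝒳 = Category 𝒳
      module H₁ = Functor H₁
      module H₂ = Functor H₂
    open _≡F_ q

    module _ {x y} (f : x 𝒳.⇒ y) where
      private
        w : p.F₀ (H₁.F₀ x) ℬ.⇒ p.F₀ (H₁.F₀ y)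
        w = cast (sym (eq₀ x)) (sym (eq₀ y)) (H₂.F₁ f)

        w-≈ʰ : w ℬ.≈ʰ H₂.F₁ f
        w-≈ʰ = cast-≈ʰ (sym (eq₀ x)) (sym (eq₀ y)) (H₂.F₁ f)

        -- `q` identifies `p_T (H₁ f)` with `η ∘ H₂ f`, and `p-η` puts `η̃` above `η`; so `H₁ f`
        -- factors through the cartesian `η̃` over `H₂ f`.
        over : p.F₁ (𝕋̃.η (H₁.F₀ y)) ℬ.∘ w ℬ.≈ p.F₁ (H₁.F₁ f)
        over = ℬ.≈ʰ⇒≈
          (ℬ.∘-resp-≈ʰ (p-η (H₁.F₀ y) ⊙ family-≈ʰ 𝕋.η (eq₀ y)) w-≈ʰ ⊙
           ℬ.≈ʰ-sym (K-≈ʰ⇒≈ʰ (eq₁ f)) ⊙ p_T-≈ʰ (H₁.F₁ f))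

        module c = IsCartesian (η̃-cartesian (H₁.F₀ y))

      F₁ : H₁.F₀ x ℰ.⇒ H₁.F₀ y
      F₁ = c.factor (H₁.F₁ f) w over

      p-F₁ : p.F₁ F₁ ℬ.≈ʰ H₂.F₁ f
      p-F₁ = ℬ.≈⇒≈ʰ (c.factor-above (H₁.F₁ f) w over) ⊙ w-≈ʰ

      η̃-F₁ : 𝕋̃.η (H₁.F₀ y) ℰ.∘ F₁ ℰ.≈ H₁.F₁ f
      η̃-F₁ = c.factor-commutes (H₁.F₁ f) w over

    -- Cancelling the cartesian `η̃` gives this, and every functor law of `universal` is an
    -- instance: it suffices to test a candidate below in `ℬ` and after `η̃`.
    F₁-unique : ∀ {x y} (f : x 𝒳.⇒ y) (h : H₁.F₀ x ℰ.⇒ H₁.F₀ y) →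
                p.F₁ h ℬ.≈ʰ H₂.F₁ f → 𝕋̃.η (H₁.F₀ y) ℰ.∘ h ℰ.≈ H₁.F₁ f → F₁ f ℰ.≈ h
    F₁-unique {y = y} f h r s = cartesian-cancel p (η̃-cartesian (H₁.F₀ y))
      (ℬ.≈ʰ⇒≈ (p-F₁ f ⊙ ℬ.≈ʰ-sym r)) (ℰ.Equiv.trans (η̃-F₁ f) (ℰ.Equiv.sym s))

    universal : Functor 𝒳 ℰ
    universal = record
      { F₀           = H₁.F₀
      ; F₁           = F₁
      ; F-resp-≈     = λ {_} {_} {f} {g} r → F₁-unique f (F₁ g)
          (p-F₁ g ⊙ ℬ.≈⇒≈ʰ (H₂.F-resp-≈ (𝒳.Equiv.sym r)))
          (ℰ.Equiv.trans (η̃-F₁ g) (H₁.F-resp-≈ (𝒳.Equiv.sym r)))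
      ; identity     = λ {x} → F₁-unique 𝒳.id ℰ.id
          (ℬ.≈⇒≈ʰ p.identity ⊙ family-≈ʰ (λ A → ℬ.id {A}) (eq₀ x) ⊙
           ℬ.≈⇒≈ʰ (ℬ.Equiv.sym H₂.identity))
          (ℰ.Equiv.trans ℰ.identityʳ (ℰ.Equiv.sym H₁.identity))
      ; homomorphism = λ {_} {_} {_} {f} {g} → F₁-unique (g 𝒳.∘ f) (F₁ g ℰ.∘ F₁ f)
          (ℬ.≈⇒≈ʰ p.homomorphism ⊙ ℬ.∘-resp-≈ʰ (p-F₁ g) (p-F₁ f) ⊙
           ℬ.≈⇒≈ʰ (ℬ.Equiv.sym H₂.homomorphism))
          -- `η̃` after a composite is `J̃` of that composite, so functoriality of `J̃` splits it
          -- into Kleisli factors equal to `H₁ g` and `H₁ f`.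
          (ℰ.Equiv.trans (J̃.homomorphism {f = F₁ f} {g = F₁ g})
            (ℰ.Equiv.trans (ℰ_T.∘-resp-≈ (η̃-F₁ g) (η̃-F₁ f)) (ℰ.Equiv.sym H₁.homomorphism)))
      }

    -- `J̃` is the identity on objects, so the first equality settles objects; on morphisms the two
    -- equalities are the hypotheses of `η̃-cancel`.
    universal-unique : (H : Functor 𝒳 ℰ) → (J̃ ∘F H) ≡F H₁ → (p ∘F H) ≡F H₂ → H ≡F universal
    universal-unique H r s = record
      { eq₀ = r.eq₀
      ; eq₁ = λ {x} {y} f → η̃-cancel (r.eq₀ x) (r.eq₀ y)
          (s.eq₁ f ⊙ ℬ.≈ʰ-sym (p-F₁ f))
          (ℰ.≈ʰ-trans (K̃.K-≈ʰ⇒≈ʰ (r.eq₁ f)) (ℰ.≈⇒≈ʰ (ℰ.Equiv.sym (η̃-F₁ f))))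
      }
      where
      module r = _≡F_ r
      module s = _≡F_ s

  J̃-pullback : ∀ {a b c} → IsPullback a b c J̃ p p_T J
  J̃-pullback = record
    { commute      = record { eq₀ = λ _ → refl ; eq₁ = λ f → ≈ʰ⇒K-≈ʰ refl (p_T-J̃ f) }
    ; universal    = λ H₁ H₂ q → Universal.universal H₁ H₂ q
    ; P₁∘universal = λ H₁ H₂ q → record
        { eq₀ = λ _ → refl ; eq₁ = λ f → ℰ_T.≈⇒≈ʰ (Universal.η̃-F₁ H₁ H₂ q f) }
    ; P₂∘universal = λ H₁ H₂ q → record
        { eq₀ = _≡F_.eq₀ q ; eq₁ = Universal.p-F₁ H₁ H₂ q }
    ; unique       = λ H₁ H₂ q → Universal.universal-unique H₁ H₂ q
    }

-- The action on a Kleisli category induced by a strength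

module _ {C : Category o ℓ e} (𝒞 : Monoidal C) where
  open Category C
  open Monoidal 𝒞
  private module ⊗ = Functor ⊗

  ⊗-resp-≈ʰ : ∀ {X X′ Y Y′ Z Z′ W W′} {f : X ⇒ X′} {g : Y ⇒ Y′} {h : Z ⇒ Z′} {k : W ⇒ W′} →
              f ≈ʰ h → g ≈ʰ k → f ⊗₁ g ≈ʰ h ⊗₁ k
  ⊗-resp-≈ʰ (≈⇒≈ʰ q) (≈⇒≈ʰ r) = ≈⇒≈ʰ (⊗.F-resp-≈ (q , r))

module StrengthProperties {C : Category o ℓ e} (𝒞 : Monoidal C) (M : Monad C)
                          (s : Strength 𝒞 M) where
  open Category C
  open CategoryProperties C
  open KleisliProperties M
  open Monoidal 𝒞
  open Monad M
  open Strength s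
  open RawAction (kleisliAction 𝒞 M s)
  private
    module K = Category (Kleisli M)
    module J = Functor (KleisliLeftAdjoint M)
    module T = Functor T
    module ⊗ = Functor ⊗

  id⊗-∘ : ∀ {X X′ Y Z W} (k : Z ⇒ W) (f : X ⇒ X′) (g : Y ⇒ Z) →
          (id ⊗₁ k) ∘ (f ⊗₁ g) ≈ f ⊗₁ (k ∘ g)
  id⊗-∘ k f g = Equiv.trans (Equiv.sym ⊗.homomorphism) (⊗.F-resp-≈ (identityˡ , Equiv.refl))

  -- By `t-η`. On arrows from `C` the action is thus the tensor, which lets coherence laws pass
  -- along `J`.
  ·-J : ∀ {X X′ Y Y′} (f : X ⇒ X′) (h : Y ⇒ Y′) → f ·₁ J.F₁ h ≈ J.F₁ (f ⊗₁ h)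
  ·-J {X′ = X′} {Y′ = Y′} f h = begin
    t X′ Y′ ∘ (f ⊗₁ (η Y′ ∘ h))         ≈⟨ refl⟩∘⟨ id⊗-∘ (η Y′) f h ⟨
    t X′ Y′ ∘ ((id ⊗₁ η Y′) ∘ (f ⊗₁ h)) ≈⟨ assoc ⟨
    (t X′ Y′ ∘ (id ⊗₁ η Y′)) ∘ (f ⊗₁ h) ≈⟨ t-η X′ Y′ ⟩∘⟨refl ⟩
    η (X′ ⊗₀ Y′) ∘ (f ⊗₁ h)             ∎
    where open HomReasoning

  ·-idᴷ : ∀ {X X′ Y} (f : X ⇒ X′) → f ·₁ K.id {Y} ≈ J.F₁ (f ⊗₁ id)
  ·-idᴷ f = Equiv.trans
    (refl⟩∘⟨ ⊗.F-resp-≈ (Equiv.refl , Equiv.sym identityʳ)) (·-J f id)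

  -- `t-μ` replaces one strength before `μ` by two, and `t-natural` slides the inner one past
  -- `f′ ⊗₁ T₁ g′`.
  ·-∘ᴷ : ∀ {m m′ m″ c c′ c″} (f : m ⇒ m′) (f′ : m′ ⇒ m″) (g : c ⇒ T₀ c′) (g′ : c′ ⇒ T₀ c″) →
         (f′ ∘ f) ·₁ (g′ K.∘ g) ≈ (f′ ·₁ g′) K.∘ (f ·₁ g)
  ·-∘ᴷ {m} {m′} {m″} {c} {c′} {c″} f f′ g g′ = begin
    τ ∘ ((f′ ∘ f) ⊗₁ (μ c″ ∘ (T₁ g′ ∘ g)))
      ≈⟨ refl⟩∘⟨ id⊗-∘ (μ c″) (f′ ∘ f) (T₁ g′ ∘ g) ⟨
    τ ∘ ((id ⊗₁ μ c″) ∘ ((f′ ∘ f) ⊗₁ (T₁ g′ ∘ g)))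
      ≈⟨ assoc ⟨
    (τ ∘ (id ⊗₁ μ c″)) ∘ ((f′ ∘ f) ⊗₁ (T₁ g′ ∘ g))
      ≈⟨ t-μ m″ c″ ⟩∘⟨ ⊗.homomorphism ⟩
    (ν ∘ (T₁ τ ∘ τT)) ∘ ((f′ ⊗₁ T₁ g′) ∘ (f ⊗₁ g))
      ≈⟨ assoc ⟩
    ν ∘ ((T₁ τ ∘ τT) ∘ ((f′ ⊗₁ T₁ g′) ∘ (f ⊗₁ g)))
      ≈⟨ refl⟩∘⟨ assoc ⟩
    ν ∘ (T₁ τ ∘ (τT ∘ ((f′ ⊗₁ T₁ g′) ∘ (f ⊗₁ g))))
      ≈⟨ refl⟩∘⟨ (refl⟩∘⟨ assoc) ⟨
    ν ∘ (T₁ τ ∘ ((τT ∘ (f′ ⊗₁ T₁ g′)) ∘ (f ⊗₁ g)))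
      ≈⟨ refl⟩∘⟨ (refl⟩∘⟨ (t-natural f′ g′ ⟩∘⟨refl)) ⟩
    ν ∘ (T₁ τ ∘ ((T₁ (f′ ⊗₁ g′) ∘ t m′ c′) ∘ (f ⊗₁ g)))
      ≈⟨ refl⟩∘⟨ (refl⟩∘⟨ assoc) ⟩
    ν ∘ (T₁ τ ∘ (T₁ (f′ ⊗₁ g′) ∘ (f ·₁ g)))
      ≈⟨ refl⟩∘⟨ assoc ⟨
    ν ∘ ((T₁ τ ∘ T₁ (f′ ⊗₁ g′)) ∘ (f ·₁ g))
      ≈⟨ refl⟩∘⟨ (T.homomorphism ⟩∘⟨refl) ⟨
    ν ∘ (T₁ (τ ∘ (f′ ⊗₁ g′)) ∘ (f ·₁ g)) ∎
    where
    open HomReasoning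
    τ  = t m″ c″
    τT = t m″ (T₀ c″)
    ν  = μ (m″ ⊗₀ c″)

  J-λ-natural : ∀ {c c′} (g : c ⇒ T₀ c′) → J.F₁ (λ⇒ c′) K.∘ (id ·₁ g) ≈ g K.∘ J.F₁ (λ⇒ c)
  J-λ-natural {c} {c′} g = begin
    J.F₁ (λ⇒ c′) K.∘ (id ·₁ g)            ≈⟨ J-∘ᴷ (λ⇒ c′) (id ·₁ g) ⟩
    T₁ (λ⇒ c′) ∘ (t I c′ ∘ (id ⊗₁ g))     ≈⟨ assoc ⟨
    (T₁ (λ⇒ c′) ∘ t I c′) ∘ (id ⊗₁ g)     ≈⟨ t-λ c′ ⟩∘⟨refl ⟩
    λ⇒ (T₀ c′) ∘ (id ⊗₁ g)                ≈⟨ λ-natural g ⟩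
    g ∘ λ⇒ c                              ≈⟨ ∘ᴷ-J g (λ⇒ c) ⟨
    g K.∘ J.F₁ (λ⇒ c)                     ∎
    where open HomReasoning

  -- `t-α` splits the strength at a tensor into two nested ones, leaving an associator at `T₀ c′` to
  -- which `α-natural` applies.
  J-α-natural : ∀ {m₁ m₁′ m₂ m₂′ c c′} (f₁ : m₁ ⇒ m₁′) (f₂ : m₂ ⇒ m₂′) (g : c ⇒ T₀ c′) →
                J.F₁ (α⇒ m₁′ m₂′ c′) K.∘ ((f₁ ⊗₁ f₂) ·₁ g) ≈
                (f₁ ·₁ (f₂ ·₁ g)) K.∘ J.F₁ (α⇒ m₁ m₂ c)
  J-α-natural {m₁} {m₁′} {m₂} {m₂′} {c} {c′} f₁ f₂ g = begin
    J.F₁ α′ K.∘ ((f₁ ⊗₁ f₂) ·₁ g)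
      ≈⟨ J-∘ᴷ α′ ((f₁ ⊗₁ f₂) ·₁ g) ⟩
    T₁ α′ ∘ (t (m₁′ ⊗₀ m₂′) c′ ∘ ((f₁ ⊗₁ f₂) ⊗₁ g))
      ≈⟨ assoc ⟨
    (T₁ α′ ∘ t (m₁′ ⊗₀ m₂′) c′) ∘ ((f₁ ⊗₁ f₂) ⊗₁ g)
      ≈⟨ t-α m₁′ m₂′ c′ ⟩∘⟨refl ⟩
    (τ ∘ ((id ⊗₁ t m₂′ c′) ∘ αT)) ∘ ((f₁ ⊗₁ f₂) ⊗₁ g)
      ≈⟨ assoc ⟩
    τ ∘ (((id ⊗₁ t m₂′ c′) ∘ αT) ∘ ((f₁ ⊗₁ f₂) ⊗₁ g))
      ≈⟨ refl⟩∘⟨ assoc ⟩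
    τ ∘ ((id ⊗₁ t m₂′ c′) ∘ (αT ∘ ((f₁ ⊗₁ f₂) ⊗₁ g)))
      ≈⟨ refl⟩∘⟨ (refl⟩∘⟨ α-natural f₁ f₂ g) ⟩
    τ ∘ ((id ⊗₁ t m₂′ c′) ∘ ((f₁ ⊗₁ (f₂ ⊗₁ g)) ∘ α⇒ m₁ m₂ c))
      ≈⟨ refl⟩∘⟨ assoc ⟨
    τ ∘ (((id ⊗₁ t m₂′ c′) ∘ (f₁ ⊗₁ (f₂ ⊗₁ g))) ∘ α⇒ m₁ m₂ c)
      ≈⟨ refl⟩∘⟨ (id⊗-∘ (t m₂′ c′) f₁ (f₂ ⊗₁ g) ⟩∘⟨refl) ⟩
    τ ∘ ((f₁ ⊗₁ (f₂ ·₁ g)) ∘ α⇒ m₁ m₂ c)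
      ≈⟨ assoc ⟨
    (f₁ ·₁ (f₂ ·₁ g)) ∘ α⇒ m₁ m₂ c
      ≈⟨ ∘ᴷ-J (f₁ ·₁ (f₂ ·₁ g)) (α⇒ m₁ m₂ c) ⟨
    (f₁ ·₁ (f₂ ·₁ g)) K.∘ J.F₁ (α⇒ m₁ m₂ c) ∎
    where
    open HomReasoning
    α′ = α⇒ m₁′ m₂′ c′
    αT = α⇒ m₁′ m₂′ (T₀ c′)
    τ  = t m₁′ (m₂′ ⊗₀ c′)

  -- Every arrow involved is an image of `J` by `·-J` and `·-idᴷ`, so this is `J` applied to
  -- `pentagon`.
  J-pentagon : ∀ m₁ m₂ m₃ c →
               J.F₁ (α⇒ m₁ m₂ (m₃ ⊗₀ c)) K.∘ J.F₁ (α⇒ (m₁ ⊗₀ m₂) m₃ c) ≈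
               (id ·₁ J.F₁ (α⇒ m₂ m₃ c)) K.∘
                 (J.F₁ (α⇒ m₁ (m₂ ⊗₀ m₃) c) K.∘ (α⇒ m₁ m₂ m₃ ·₁ K.id))
  J-pentagon m₁ m₂ m₃ c = begin
    J.F₁ (α⇒ m₁ m₂ (m₃ ⊗₀ c)) K.∘ J.F₁ (α⇒ (m₁ ⊗₀ m₂) m₃ c)
      ≈⟨ J.homomorphism ⟨
    J.F₁ (α⇒ m₁ m₂ (m₃ ⊗₀ c) ∘ α⇒ (m₁ ⊗₀ m₂) m₃ c)
      ≈⟨ J.F-resp-≈ (pentagon m₁ m₂ m₃ c) ⟨
    J.F₁ ((id ⊗₁ α⇒ m₂ m₃ c) ∘ (α⇒ m₁ (m₂ ⊗₀ m₃) c ∘ (α⇒ m₁ m₂ m₃ ⊗₁ id)))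
      ≈⟨ J.homomorphism ⟩
    J.F₁ (id ⊗₁ α⇒ m₂ m₃ c) K.∘ J.F₁ (α⇒ m₁ (m₂ ⊗₀ m₃) c ∘ (α⇒ m₁ m₂ m₃ ⊗₁ id))
      ≈⟨ K.∘-resp-≈ (Equiv.sym (·-J id (α⇒ m₂ m₃ c)))
           (Equiv.trans J.homomorphism
             (K.∘-resp-≈ Equiv.refl (Equiv.sym (·-idᴷ (α⇒ m₁ m₂ m₃))))) ⟩
    (id ·₁ J.F₁ (α⇒ m₂ m₃ c)) K.∘
      (J.F₁ (α⇒ m₁ (m₂ ⊗₀ m₃) c) K.∘ (α⇒ m₁ m₂ m₃ ·₁ K.id)) ∎
    where open HomReasoning

  J-triangle : ∀ m c → (id ·₁ J.F₁ (λ⇒ c)) K.∘ J.F₁ (α⇒ m I c) ≈ ρ⇒ m ·₁ K.id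
  J-triangle m c = begin
    (id ·₁ J.F₁ (λ⇒ c)) K.∘ J.F₁ (α⇒ m I c)  ≈⟨ K.∘-resp-≈ (·-J id (λ⇒ c)) Equiv.refl ⟩
    J.F₁ (id ⊗₁ λ⇒ c) K.∘ J.F₁ (α⇒ m I c)    ≈⟨ J.homomorphism ⟨
    J.F₁ ((id ⊗₁ λ⇒ c) ∘ α⇒ m I c)           ≈⟨ J.F-resp-≈ (triangle m c) ⟩
    J.F₁ (ρ⇒ m ⊗₁ id)                        ≈⟨ ·-idᴷ (ρ⇒ m) ⟨
    ρ⇒ m ·₁ K.id                             ∎
    where open HomReasoning

  kleisliAction-isAction : IsAction (kleisliAction 𝒞 M s)
  kleisliAction-isAction = record
    { ·-resp-≈       = λ q r → refl⟩∘⟨ ⊗.F-resp-≈ (q , r)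
    -- The Kleisli identity is `η`, so the law unfolds to `t-η` itself.
    ; ·-identity     = λ {m} {c} → t-η m c
    ; ·-homomorphism = λ {_} {_} {_} {_} {_} {_} {f} {f′} {g} {g′} → ·-∘ᴷ f f′ g g′
    ; ηᵃ-iso         = λ c → F-resp-iso (KleisliLeftAdjoint M) (λ-iso c)
    ; ηᵃ-natural     = J-λ-natural
    ; μᵃ-iso         = λ m₁ m₂ c → F-resp-iso (KleisliLeftAdjoint M) (α-iso m₁ m₂ c)
    ; μᵃ-natural     = J-α-natural
    ; μᵃ-coherence   = J-pentagon
    ; ηᵃ-coherence   = J-triangle
    }

-- Change of base of an action along a strict monoidal functor

module ChangeOfBase {M : Category o ℓ e} {N : Category o′ ℓ′ e′} {C : Category o″ ℓ″ e″}
                    {ℳ : Monoidal M} {𝒩 : Monoidal N} {F : Functor M N}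
                    (sm : IsStrictMonoidal ℳ 𝒩 F) (A : RawAction 𝒩 C) where
  open Category C
  open CategoryProperties C
  open Functor F
  open IsStrictMonoidal sm
  open RawAction A
  private
    module N = Category N
    module N-Properties = CategoryProperties N
    module ℳ = Monoidal ℳ
    module FA = RawAction (changeOfBase sm A)

  ηᵃ-≈ʰ : ∀ c → FA.ηᵃ c ≈ʰ ηᵃ c
  ηᵃ-≈ʰ c = subst-dom-≈ʰ (_·₀ c) (sym F-I) (ηᵃ c)

  μᵃ-≈ʰ : ∀ m₁ m₂ c → FA.μᵃ m₁ m₂ c ≈ʰ μᵃ (F₀ m₁) (F₀ m₂) c
  μᵃ-≈ʰ m₁ m₂ c = subst-dom-≈ʰ (_·₀ c) (sym (F-⊗₀ m₁ m₂)) (μᵃ (F₀ m₁) (F₀ m₂) c)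

  -- Each law is the law of `A` at images under `F`. For the laws about `ηᵃ` and `μᵃ`, passing to
  -- `≈ʰ` discards the transports, and strictness of `F` matches units, tensors and coherence maps.
  changeOfBase-isAction : IsAction A → IsAction (changeOfBase sm A)
  changeOfBase-isAction isA = record
    { ·-resp-≈       = λ q r → ·-resp-≈ (F-resp-≈ q) r
    ; ·-identity     = Equiv.trans (·-resp-≈ identity Equiv.refl) ·-identity
    ; ·-homomorphism = Equiv.trans (·-resp-≈ homomorphism Equiv.refl) ·-homomorphism
    ; ηᵃ-iso         = λ c → subst-dom-iso (_·₀ c) (sym F-I) (ηᵃ-iso c)
    ; ηᵃ-natural     = λ {c} {c′} g → ≈ʰ⇒≈
        (∘-resp-≈ʰ (ηᵃ-≈ʰ c′) (·-resp-≈ʰ F-idᴵ ≈ʰ-refl) ⊙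
         ≈⇒≈ʰ (ηᵃ-natural g) ⊙
         ∘-resp-≈ʰ ≈ʰ-refl (≈ʰ-sym (ηᵃ-≈ʰ c)))
    ; μᵃ-iso         = λ m₁ m₂ c →
        subst-dom-iso (_·₀ c) (sym (F-⊗₀ m₁ m₂)) (μᵃ-iso (F₀ m₁) (F₀ m₂) c)
    ; μᵃ-natural     = λ {m₁} {m₁′} {m₂} {m₂′} {c} {c′} f₁ f₂ g → ≈ʰ⇒≈
        (∘-resp-≈ʰ (μᵃ-≈ʰ m₁′ m₂′ c′) (·-resp-≈ʰ (F-⊗₁ f₁ f₂) ≈ʰ-refl) ⊙
         ≈⇒≈ʰ (μᵃ-natural (F₁ f₁) (F₁ f₂) g) ⊙
         ∘-resp-≈ʰ ≈ʰ-refl (≈ʰ-sym (μᵃ-≈ʰ m₁ m₂ c)))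
    ; μᵃ-coherence   = λ m₁ m₂ m₃ c → ≈ʰ⇒≈
        (∘-resp-≈ʰ (μᵃ-≈ʰ m₁ m₂ (F₀ m₃ ·₀ c))
           (μᵃ-≈ʰ (m₁ ℳ.⊗₀ m₂) m₃ c ⊙
            family-≈ʰ (λ x → μᵃ x (F₀ m₃) c) (F-⊗₀ m₁ m₂)) ⊙
         ≈⇒≈ʰ (μᵃ-coherence (F₀ m₁) (F₀ m₂) (F₀ m₃) c) ⊙
         ∘-resp-≈ʰ (·-resp-≈ʰ F-id (≈ʰ-sym (μᵃ-≈ʰ m₂ m₃ c)))
           (∘-resp-≈ʰ
             (family-≈ʰ (λ x → μᵃ (F₀ m₁) x c) (sym (F-⊗₀ m₂ m₃)) ⊙
              ≈ʰ-sym (μᵃ-≈ʰ m₁ (m₂ ℳ.⊗₀ m₃) c))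
             (·-resp-≈ʰ (N.≈ʰ-sym (F-α m₁ m₂ m₃)) ≈ʰ-refl)))
    ; ηᵃ-coherence   = λ m c → ≈ʰ⇒≈
        (∘-resp-≈ʰ (·-resp-≈ʰ (N.≈ʰ-sym F-id) (ηᵃ-≈ʰ c))
           (μᵃ-≈ʰ m ℳ.I c ⊙ family-≈ʰ (λ x → μᵃ (F₀ m) x c) F-I) ⊙
         ≈⇒≈ʰ (ηᵃ-coherence (F₀ m) c) ⊙
         ·-resp-≈ʰ (N.≈ʰ-sym (F-ρ m)) ≈ʰ-refl)
    }
    where
    open IsAction isA

    ·-resp-≈ʰ : ∀ {m m′ n n′ c c′ d d′} {f : m N.⇒ m′} {f′ : n N.⇒ n′}
                {g : c ⇒ c′} {g′ : d ⇒ d′} → f N.≈ʰ f′ → g ≈ʰ g′ → f ·₁ g ≈ʰ f′ ·₁ g′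
    ·-resp-≈ʰ (N.≈⇒≈ʰ q) (≈⇒≈ʰ r) = ≈⇒≈ʰ (·-resp-≈ q r)

    F-id : ∀ {m} → N.id {F₀ m} N.≈ʰ F₁ (Category.id M {m})
    F-id = N.≈⇒≈ʰ (N.Equiv.sym identity)

    F-idᴵ : F₁ (Category.id M {ℳ.I}) N.≈ʰ N.id {Monoidal.I 𝒩}
    F-idᴵ = N.≈ʰ-trans (N.≈ʰ-sym F-id) (N-Properties.family-≈ʰ (λ X → N.id {X}) F-I)

-- Strict preservation of the action

module _ {ℰ : Category o ℓ e} {ℬ : Category o′ ℓ′ e′} {p : Functor ℰ ℬ} (𝕄 : FibredMonad p)
         {mℰ : Monoidal ℰ} {mℬ : Monoidal ℬ} (p-strict : IsStrictMonoidal mℰ mℬ p)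
         (s̃ : Strength mℰ (FibredMonad.𝕋̃ 𝕄)) (s : Strength mℬ (FibredMonad.𝕋 𝕄)) where
  open FibredMonad 𝕄
  open FibredMonadProperties 𝕄
  open CategoryProperties ℬ
  open KleisliProperties 𝕋
  open IsStrictMonoidal p-strict
  private
    module ℬ = Category ℬ
    module p = Functor p
    module mℰ = Monoidal mℰ
    module B = ChangeOfBase p-strict (kleisliAction mℬ 𝕋 s)

  -- On arrows, `above` matches the strengths and `F-⊗₁` the tensors. The structure maps are images
  -- under `J̃` and `J`, so `p_T-J̃` reduces them to `F-λ` and `F-α`.
  p_T-strictlyPreserves :
    StrengthAbove 𝕄 s̃ s →
    StrictlyPreserves (kleisliAction mℰ 𝕋̃ s̃) (changeOfBase p-strict (kleisliAction mℬ 𝕋 s)) p_T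
  p_T-strictlyPreserves above = record
    { pres-·₀ = F-⊗₀
    ; pres-·₁ = λ {_} {m′} {_} {c′} f g → ≈ʰ⇒K-≈ʰ (F-⊗₀ m′ c′)
        (p_T-≈ʰ _ ⊙ ℬ.≈⇒≈ʰ p.homomorphism ⊙
         ℬ.∘-resp-≈ʰ (above m′ c′)
           (F-⊗₁ f g ⊙ ⊗-resp-≈ʰ mℬ ℬ.≈ʰ-refl (ℬ.≈ʰ-sym (p_T-≈ʰ g))))
    ; pres-η  = λ c → ≈ʰ⇒K-≈ʰ refl
        (p_T-J̃ (mℰ.λ⇒ c) ⊙ ℬ.∘-resp-≈ʰ ℬ.≈ʰ-refl (F-λ c) ⊙
         ℬ.≈ʰ-sym (K-≈ʰ⇒≈ʰ (B.ηᵃ-≈ʰ (p.F₀ c))))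
    ; pres-μ  = λ m₁ m₂ c →
        -- The codomain is a nested tensor, so strictness is applied twice; `q` serves both the
        -- Kleisli codomain and the index of `η`.
        let q = trans (F-⊗₀ m₁ (m₂ mℰ.⊗₀ c)) (cong (p.F₀ m₁ ⊗₀_) (F-⊗₀ m₂ c)) in
        ≈ʰ⇒K-≈ʰ q
          (p_T-J̃ (mℰ.α⇒ m₁ m₂ c) ⊙ ℬ.∘-resp-≈ʰ (family-≈ʰ 𝕋.η q) (F-α m₁ m₂ c) ⊙
           ℬ.≈ʰ-sym (K-≈ʰ⇒≈ʰ (B.μᵃ-≈ʰ m₁ m₂ (p.F₀ c))))
    }
    where open Monoidal mℬ using (_⊗₀_)

proposition31 :
  ∀ {o ℓ e o′ ℓ′ e′ a b c : Level}
    {ℰ : Category o ℓ e} {ℬ : Category o′ ℓ′ e′} (p : Functor ℰ ℬ) →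
    IsFibration p → (𝕄 : FibredMonad p) →
    let open FibredMonad 𝕄 in
    (IsFibration p_T × IsPullback a b c J̃ p p_T J)
    ×
    ((mℰ : Monoidal ℰ) (mℬ : Monoidal ℬ) (p-strict : IsStrictMonoidal mℰ mℬ p)
     (s̃ : Strength mℰ 𝕋̃) (s : Strength mℬ 𝕋) → StrengthAbove 𝕄 s̃ s →
     let ℰ-on-ℰ_T = kleisliAction mℰ 𝕋̃ s̃
         ℰ-on-ℬ_T = changeOfBase p-strict (kleisliAction mℬ 𝕋 s)
     in IsAction ℰ-on-ℰ_T × IsAction ℰ-on-ℬ_T × StrictlyPreserves ℰ-on-ℰ_T ℰ-on-ℬ_T p_T)
proposition31 p fib 𝕄 =
  (p_T-fibration fib , J̃-pullback) ,
  λ mℰ mℬ p-strict s̃ s above →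
    StrengthProperties.kleisliAction-isAction mℰ 𝕋̃ s̃ ,
    ChangeOfBase.changeOfBase-isAction p-strict (kleisliAction mℬ 𝕋 s)
      (StrengthProperties.kleisliAction-isAction mℬ 𝕋 s) ,
    p_T-strictlyPreserves 𝕄 p-strict s̃ s above
  where
  open FibredMonad 𝕄
  open FibredMonadProperties 𝕄
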